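{- For all integers $t\ge 0$ and $n\ge 1$, the following identity of rational functions in $x$ holds: $$\overline{N}^{(t)}_{n+1}(x)=\frac{a_0+a_1x+a_2x^2}{(n+t+1)(n+3)(c_0+c_1x)}\,\overline{N}^{(t)}_{n}(x)-\frac{n(n+t)(x-1)^2(b_0+b_1x)}{(n+t+1)(n+3)(c_0+c_1x)}\,\overline{N}^{(t)}_{n-1}(x),$$ where $$\begin{aligned} a_0&=-(2n+3)(n+t)(n+t+1),\\ a_1&=\tfrac{3}{2}t(t-2)(t+1)^2+t(t-2)(t^2+7t+5)n+3t(t-2)(t+2)n^2+2t(t-2)n^3,\\ a_2&=\tfrac12 t^2(t-1)(t+1)^2+(t-1)(2t^3+3t^2+t-3)n+(t-1)(3t^2+3t-5)n^2+2(t-1)^2n^3,\\ b_0&=-n-1-t,\\ b_1&=(t-1)^2n+\tfrac12(t-1)t^2+(t-1)^2,\\ c_0&=-n-t,\\ c_1&=(t-1)^2n+\tfrac12(t-1)t^2. \end{aligned}$$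
   Context: For nonnegative integers $n,m$ let $$N_{n,m}(x)=\sum_{k=0}^{n}\left(\binom{n}{k}\binom{m}{k}-\binom{n}{k+1}\binom{m}{k-1}\right)x^k,$$ where $\binom{a}{b}=0$ if $b<0$ or $b>a$. For nonnegative integers $t$ and $n$, put $\overline{N}^{(t)}_n(x)=N_{n+t,n}(x)$. -}

module Defs where

open import Agda.Builtin.FromNat using (Number; fromNat)
import Algebra.Definitions.RawSemiring
open import Data.Unit.Base using (⊤; tt)
open import Data.Nat.Base as ℕ using (ℕ; zero; suc)
open import Data.Nat.Combinatorics using (_C_)
import Data.Nat.Literals as ℕLit
open import Data.Integer.Base as ℤ using (ℤ; +_; -[1+_]; _⊖_)
open import Data.Rational.Base
open import Data.Rational.Properties
import Data.Rational.Literals as ℚLit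
open import Data.List.Base using (List; []; _∷_; map; applyUpTo)
open import Data.Sum.Base using (_⊎_; inj₁; inj₂; [_,_])
open import Relation.Nullary using (¬_; yes; no; contradiction)
open import Relation.Binary.PropositionalEquality

instance
  numberℕ : Number ℕ
  numberℕ = ℕLit.number

  numberℚ : Number ℚ
  numberℚ = ℚLit.number

open Algebra.Definitions.RawSemiring +-*-rawSemiring using (_^_)

-- The list a₀ ∷ a₁ ∷ … ∷ [] stands for a₀ + a₁x + …; trailing zeros are
-- allowed, so polynomials are compared by _≈ₚ_ and not by _≡_.
Poly : Set
Poly = List ℚ

coeff : Poly → ℕ → ℚ
coeff []      _       = 0ℚ
coeff (a ∷ p) zero    = a
coeff (a ∷ p) (suc k) = coeff p k

infix  4 _≈ₚ_ _≈ᶠ_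
infixl 6 _+ₚ_ _-ₚ_ _-ᶠ_
infixl 7 _*ₚ_ _*ᶠ_

_≈ₚ_ : Poly → Poly → Set
p ≈ₚ q = ∀ k → coeff p k ≡ coeff q k

_+ₚ_ : Poly → Poly → Poly
[]      +ₚ q       = q
(a ∷ p) +ₚ []      = a ∷ p
(a ∷ p) +ₚ (b ∷ q) = (a + b) ∷ (p +ₚ q)

scale : ℚ → Poly → Poly
scale c = map (c *_)

_-ₚ_ : Poly → Poly → Poly
p -ₚ q = p +ₚ map (-_) q

_*ₚ_ : Poly → Poly → Poly
[]      *ₚ q = []
(a ∷ p) *ₚ q = scale a q +ₚ (0ℚ ∷ (p *ₚ q))

const : ℚ → Poly
const c = c ∷ []

X : Poly
X = 0 ∷ 1 ∷ []

*-zero-product : ∀ a b → a * b ≡ 0ℚ → a ≡ 0ℚ ⊎ b ≡ 0ℚ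
*-zero-product a b ab≡0 with a ≟ 0ℚ
... | yes a≡0 = inj₁ a≡0
... | no  a≢0 = inj₂ (begin
  b                ≡⟨ *-identityˡ b ⟨
  1ℚ * b           ≡⟨ cong (_* b) (*-inverseˡ a) ⟨
  1/ a * a * b     ≡⟨ *-assoc (1/ a) a b ⟩
  1/ a * (a * b)   ≡⟨ cong (1/ a *_) ab≡0 ⟩
  1/ a * 0ℚ        ≡⟨ *-zeroʳ (1/ a) ⟩
  0ℚ               ∎)
  where
  open ≡-Reasoning
  instance _ = ≢-nonZero a≢0

coeff-+ : ∀ p q k → coeff (p +ₚ q) k ≡ coeff p k + coeff q k
coeff-+ []      q       k       = sym (+-identityˡ (coeff q k))
coeff-+ (a ∷ p) []      k       = sym (+-identityʳ (coeff (a ∷ p) k))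
coeff-+ (a ∷ p) (b ∷ q) zero    = refl
coeff-+ (a ∷ p) (b ∷ q) (suc k) = coeff-+ p q k

coeff-scale : ∀ c p k → coeff (scale c p) k ≡ c * coeff p k
coeff-scale c []      k       = sym (*-zeroʳ c)
coeff-scale c (a ∷ p) zero    = refl
coeff-scale c (a ∷ p) (suc k) = coeff-scale c p k

coeff-∷* : ∀ a p q k →
  coeff ((a ∷ p) *ₚ q) k ≡ a * coeff q k + coeff (0ℚ ∷ (p *ₚ q)) k
coeff-∷* a p q k = trans (coeff-+ (scale a q) (0ℚ ∷ (p *ₚ q)) k)
                         (cong (_+ _) (coeff-scale a q k))

coeff-*∷-zero : ∀ p b q → b ≡ 0ℚ → coeff (p *ₚ (b ∷ q)) zero ≡ 0ℚ
coeff-*∷-zero []      b q b≡0 = refl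
coeff-*∷-zero (a ∷ p) b q b≡0 =
  trans (+-identityʳ (a * b)) (trans (cong (a *_) b≡0) (*-zeroʳ a))

coeff-*∷-suc : ∀ p b q → b ≡ 0ℚ → ∀ k →
  coeff (p *ₚ (b ∷ q)) (suc k) ≡ coeff (p *ₚ q) k
coeff-*∷-suc []      b q b≡0 k = refl
coeff-*∷-suc (a ∷ p) b q b≡0 k =
  trans (coeff-∷* a p (b ∷ q) (suc k))
        (trans (cong (λ z → a * coeff q k + z) (shifted k)) (sym (coeff-∷* a p q k)))
  where
  shifted : ∀ k → coeff (p *ₚ (b ∷ q)) k ≡ coeff (0ℚ ∷ (p *ₚ q)) k
  shifted zero    = coeff-*∷-zero p b q b≡0
  shifted (suc k) = coeff-*∷-suc p b q b≡0 k

cancel-∷ : ∀ a p q → a ≢ 0ℚ → (a ∷ p) *ₚ q ≈ₚ [] → q ≈ₚ []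
cancel-∷ a p []      a≢0 eq k = refl
cancel-∷ a p (b ∷ q) a≢0 eq   = λ where
    zero    → b≡0
    (suc k) → cancel-∷ a p q a≢0
                (λ j → trans (sym (coeff-*∷-suc (a ∷ p) b q b≡0 j)) (eq (suc j))) k
  where
  b≡0 : b ≡ 0ℚ
  b≡0 = [ (λ a≡0 → contradiction a≡0 a≢0) , (λ b≡0 → b≡0) ]
          (*-zero-product a b (trans (sym (+-identityʳ (a * b))) (eq zero)))

*ₚ-zero-product : ∀ p q → p *ₚ q ≈ₚ [] → p ≈ₚ [] ⊎ q ≈ₚ []
*ₚ-zero-product []      q eq = inj₁ (λ _ → refl)
*ₚ-zero-product (a ∷ p) q eq with a ≟ 0ℚ
... | no  a≢0  = inj₂ (cancel-∷ a p q a≢0 eq)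
... | yes a≡0 with *ₚ-zero-product p q tail≈0
  where
  open ≡-Reasoning
  tail≈0 : p *ₚ q ≈ₚ []
  tail≈0 k = begin
    coeff (p *ₚ q) k                              ≡⟨ +-identityˡ _ ⟨
    0ℚ + coeff (p *ₚ q) k                         ≡⟨ cong (_+ coeff (p *ₚ q) k) (*-zeroˡ (coeff q (suc k))) ⟨
    0ℚ * coeff q (suc k) + coeff (p *ₚ q) k       ≡⟨ cong (λ z → z * coeff q (suc k) + coeff (p *ₚ q) k) a≡0 ⟨
    a * coeff q (suc k) + coeff (p *ₚ q) k        ≡⟨ coeff-∷* a p q (suc k) ⟨
    coeff ((a ∷ p) *ₚ q) (suc k)                  ≡⟨ eq (suc k) ⟩
    0ℚ                                            ∎
...   | inj₁ p≈0 = inj₁ (λ where zero → a≡0; (suc k) → p≈0 k)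
...   | inj₂ q≈0 = inj₂ q≈0

-- The field ℚ(x), as fractions of polynomials compared by cross-multiplication.
record RatFun : Set where
  constructor frac
  field
    num   : Poly
    den   : Poly
    den≉0 : ¬ (den ≈ₚ [])

open RatFun public

_≈ᶠ_ : RatFun → RatFun → Set
f ≈ᶠ g = num f *ₚ den g ≈ₚ num g *ₚ den f

den-*≉0 : ∀ f g → ¬ (den f *ₚ den g ≈ₚ [])
den-*≉0 f g eq = [ den≉0 f , den≉0 g ] (*ₚ-zero-product (den f) (den g) eq)

_*ᶠ_ : RatFun → RatFun → RatFun
f *ᶠ g = frac (num f *ₚ num g) (den f *ₚ den g) (den-*≉0 f g)

_-ᶠ_ : RatFun → RatFun → RatFun
f -ᶠ g = frac (num f *ₚ den g -ₚ num g *ₚ den f) (den f *ₚ den g) (den-*≉0 f g)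

fromPoly : Poly → RatFun
fromPoly p = frac p (const 1ℚ) (λ 1≈0 → contradiction (1≈0 zero) (λ ()))

-- The lower index is an integer because it takes the value -1.
binom : ℕ → ℤ → ℕ
binom a (+ b)    = a C b
binom a -[1+ _ ] = 0

Ncoeff : ℕ → ℕ → ℕ → ℤ
Ncoeff n m k =
  + (binom n (+ k) ℕ.* binom m (+ k)) ℤ.- + (binom n (+ suc k) ℕ.* binom m (k ⊖ 1))

Npoly : ℕ → ℕ → Poly
Npoly n m = applyUpTo (λ k → ℚLit.fromℤ (Ncoeff n m k)) (suc n)

Nbar : ℕ → ℕ → Poly
Nbar t n = Npoly (n ℕ.+ t) n

fromℕ : ℕ → ℚ
fromℕ n = ℚLit.fromℤ (+ n)

a₀ a₁ a₂ b₀ b₁ c₀ c₁ : ℚ → ℚ → ℚ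
a₀ t n = - (2 * n + 3) * (n + t) * (n + t + 1)
a₁ t n = + 3 / 2 * t * (t - 2) * (t + 1) ^ 2
       + t * (t - 2) * (t ^ 2 + 7 * t + 5) * n
       + 3 * t * (t - 2) * (t + 2) * n ^ 2
       + 2 * t * (t - 2) * n ^ 3
a₂ t n = ½ * t ^ 2 * (t - 1) * (t + 1) ^ 2
       + (t - 1) * (2 * t ^ 3 + 3 * t ^ 2 + t - 3) * n
       + (t - 1) * (3 * t ^ 2 + 3 * t - 5) * n ^ 2
       + 2 * (t - 1) ^ 2 * n ^ 3
b₀ t n = - n - 1 - t
b₁ t n = (t - 1) ^ 2 * n + ½ * (t - 1) * t ^ 2 + (t - 1) ^ 2
c₀ t n = - n - t
c₁ t n = (t - 1) ^ 2 * n + ½ * (t - 1) * t ^ 2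

denominator : ℚ → ℚ → Poly
denominator t n = const ((n + t + 1) * (n + 3)) *ₚ (c₀ t n ∷ c₁ t n ∷ [])

-- The constant coefficient is nonzero since c₀ = -(n + t) < 0 for n ≥ 1.
denominator≉0 : ∀ t n → 1 ℕ.≤ n → ¬ (denominator (fromℕ t) (fromℕ n) ≈ₚ [])
denominator≉0 t n@(suc _) _ = nonzero (fromℕ t) (fromℕ n) _ _ (nonPos-fromℕ t)
  where
  nonPos-fromℕ : ∀ k → NonPositive (- fromℕ k)
  nonPos-fromℕ zero    = _
  nonPos-fromℕ (suc k) = _

  nonzero : ∀ t n → NonNegative t → Positive n → NonPositive (- t) →
            ¬ (denominator t n ≈ₚ [])
  nonzero t n t≥0 n>0 t≥0′ eq =
    [ (λ s≈0 → <⇒≢ 0<s (sym (s≈0 zero))) , (λ l≈0 → <⇒≢ c₀<0 (l≈0 zero)) ]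
      (*ₚ-zero-product (const ((n + t + 1) * (n + 3))) (c₀ t n ∷ c₁ t n ∷ []) eq)
    where
    n+t+1>0 : Positive (n + t + 1)
    n+t+1>0 = pos+pos⇒pos (n + t) {{pos+nonNeg⇒pos n {{n>0}} t {{t≥0}}}} 1

    n+3>0 : Positive (n + 3)
    n+3>0 = pos+pos⇒pos n {{n>0}} 3

    0<s : 0ℚ < (n + t + 1) * (n + 3)
    0<s = positive⁻¹ _ {{pos*pos⇒pos (n + t + 1) {{n+t+1>0}} (n + 3) {{n+3>0}}}}

    c₀<0 : c₀ t n < 0ℚ
    c₀<0 = negative⁻¹ _ {{neg+nonPos⇒neg (- n) {{neg-pos {n} n>0}} (- t) {{t≥0′}}}}

{-# OPTIONS --safe #-}

-- The coefficient of x^j in N_{m+t,m} collapses to a single hypergeometric term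
--   (m + 1 - j t) (m + t)! m! / ((j + 1)! j! (m + t - j)! (m + 1 - j)!).
-- Comparing coefficients of x^j in the recurrence with denominators cleared, all
-- nine terms that occur are polynomial multiples of one common term, so what
-- remains is a polynomial identity in n, t and j.

module Submission where

open import Defs
open import Data.Nat.Base using (ℕ; suc; _∸_; _≤_)
open import Data.Rational.Base using (1ℚ; _+_; _*_)
open import Data.List.Base using ([]; _∷_)

open import Algebra.Bundles using (CommutativeRing)
import Algebra.Definitions.RawSemiring as RawSemiring
import Algebra.Solver.Ring as Solver
open import Algebra.Solver.Ring.AlmostCommutativeRing using (fromCommutativeRing; _-Raw-AlmostCommutative⟶_)
open import Data.Fin.Patterns using (0F; 1F; 2F; 3F; 4F)
open import Data.Integer.Base as ℤ using (ℤ; +_; -[1+_]; _⊖_)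
import Data.Integer.Properties as ℤ
open import Data.List.Base using (map; applyUpTo)
open import Data.Maybe.Base using (Maybe)
open import Data.Nat.Base as ℕ using (zero; _!; z≤n; s≤s)
open import Data.Nat.Combinatorics using (_C_; nCk+nC[k+1]≡[n+1]C[k+1]; k>n⇒nCk≡0)
import Data.Nat.Properties as ℕ
open import Data.Rational.Base using (ℚ; 0ℚ; ½; _-_; -_; 1/_; +-*-rawSemiring)
open import Data.Rational.Literals using (fromℤ)
open import Data.Rational.Properties
  using (+-*-commutativeRing; toℚᵘ-injective; toℚᵘ-homo-+; toℚᵘ-homo-*; toℚᵘ-homo‿-;
         +-identityˡ; +-identityʳ; *-identityˡ; *-identityʳ; *-zeroˡ; *-zeroʳ; *-inverseʳ)
open import Data.Rational.Unnormalised.Base using (*≡*)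
open import Data.Rational.Unnormalised.Properties using (≃-sym; ≃-trans)
open import Data.Vec.Base using (Vec; []; _∷_)
open import Function.Base using (_∘_; _$_)
open import Relation.Binary.PropositionalEquality
import Relation.Binary.Reasoning.Setoid as SetoidReasoning
open import Relation.Nullary.Decidable using (dec⇒maybe; map′)

open RawSemiring +-*-rawSemiring using (_^_)
open ≡-Reasoning

-- The ring embedding of ℤ into ℚ and the ring solver.

fromℤ-+ : ∀ i j → fromℤ (i ℤ.+ j) ≡ fromℤ i + fromℤ j
fromℤ-+ i j = toℚᵘ-injective (≃-trans
  (*≡* (cong (ℤ._* + 1) (sym (cong₂ ℤ._+_ (ℤ.*-identityʳ i) (ℤ.*-identityʳ j)))))
  (≃-sym (toℚᵘ-homo-+ (fromℤ i) (fromℤ j))))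

fromℤ-* : ∀ i j → fromℤ (i ℤ.* j) ≡ fromℤ i * fromℤ j
fromℤ-* i j = toℚᵘ-injective (≃-sym (toℚᵘ-homo-* (fromℤ i) (fromℤ j)))

fromℤ-neg : ∀ i → fromℤ (ℤ.- i) ≡ - fromℤ i
fromℤ-neg i = toℚᵘ-injective (≃-sym (toℚᵘ-homo‿- (fromℤ i)))

fromℤ-morphism : CommutativeRing.rawRing ℤ.+-*-commutativeRing
                   -Raw-AlmostCommutative⟶ fromCommutativeRing +-*-commutativeRing
fromℤ-morphism = record
  { ⟦_⟧    = fromℤ
  ; +-homo = fromℤ-+
  ; *-homo = fromℤ-*
  ; -‿homo = fromℤ-neg
  ; 0-homo = refl
  ; 1-homo = refl
  }

fromℤ-≟ : ∀ i j → Maybe (fromℤ i ≡ fromℤ j)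
fromℤ-≟ i j = dec⇒maybe (map′ (cong fromℤ) (λ where refl → refl) (i ℤ.≟ j))

-- Integer coefficients: normalising with rational ones would compute a gcd at
-- every step.
open Solver (CommutativeRing.rawRing ℤ.+-*-commutativeRing)
            (fromCommutativeRing +-*-commutativeRing)
            fromℤ-morphism fromℤ-≟

fromℤ-- : ∀ i j → fromℤ (i ℤ.- j) ≡ fromℤ i - fromℤ j
fromℤ-- i j = trans (fromℤ-+ i (ℤ.- j)) (cong (λ x → fromℤ i + x) (fromℤ-neg j))

fromℤ-pred : ∀ j → fromℤ (ℤ.pred j) ≡ fromℤ j - 1ℚ
fromℤ-pred j = trans (fromℤ-+ (ℤ.- + 1) j) (solve 1 (λ x → con (ℤ.- + 1) :+ x := x :- con (+ 1)) refl (fromℤ j))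

fromℤ-suc : ∀ j → fromℤ (ℤ.suc j) ≡ fromℤ j + 1ℚ
fromℤ-suc j = trans (fromℤ-+ (+ 1) j) (solve 1 (λ x → con (+ 1) :+ x := x :+ con (+ 1)) refl (fromℤ j))

fromℕ-suc : ∀ n → fromℕ (suc n) ≡ fromℕ n + 1ℚ
fromℕ-suc n = fromℤ-suc (+ n)

fromℕ-+ : ∀ m n → fromℕ (m ℕ.+ n) ≡ fromℕ m + fromℕ n
fromℕ-+ m n = fromℤ-+ (+ m) (+ n)

fromℕ-* : ∀ m n → fromℕ (m ℕ.* n) ≡ fromℕ m * fromℕ n
fromℕ-* m n = trans (cong fromℤ (ℤ.pos-* m n)) (fromℤ-* (+ m) (+ n))

-- Reciprocal factorials on ℤ and binomial coefficients.

-- With 1/j! = 0 for j < 0, the relation 1/j! = (j + 1)/(j + 1)! holds for all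
-- integers j, so that no boundary case arises in the recurrences below.
invFact : ℤ → ℚ
invFact (+ zero)    = 1ℚ
invFact (+ (suc n)) = invFact (+ n) * 1/ fromℕ (suc n)
invFact -[1+ _ ]    = 0ℚ

invFact-suc : ∀ j → invFact j ≡ fromℤ (ℤ.suc j) * invFact (ℤ.suc j)
invFact-suc (+ n) = sym (begin
  s * (i * 1/ s)  ≡⟨ solve 3 (λ s i r → s :* (i :* r) := i :* (s :* r)) refl s i (1/ s) ⟩
  i * (s * 1/ s)  ≡⟨ cong (i *_) (*-inverseʳ s) ⟩
  i * 1ℚ          ≡⟨ *-identityʳ i ⟩
  i               ∎)
  where
  i = invFact (+ n)
  s = fromℕ (suc n)
-- At j = -1 the factor `fromℤ (ℤ.suc j)` vanishes and makes up for `invFact (+ 0)` being 1.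
invFact-suc -[1+ zero ]  = refl
invFact-suc -[1+ suc n ] = sym (*-zeroʳ (fromℤ -[1+ n ]))

invFact-pred : ∀ j → invFact (ℤ.pred j) ≡ fromℤ j * invFact j
invFact-pred j = trans (invFact-suc (ℤ.pred j)) (cong (λ i → fromℤ i * invFact i) (ℤ.suc-pred j))

invFact-minus : ∀ m j → invFact (+ m ℤ.- j) ≡ (fromℕ m + 1ℚ - fromℤ j) * invFact (+ suc m ℤ.- j)
invFact-minus m j = begin
  invFact (+ m ℤ.- j)                                        ≡⟨ invFact-suc (+ m ℤ.- j) ⟩
  fromℤ (ℤ.suc (+ m ℤ.- j)) * invFact (ℤ.suc (+ m ℤ.- j))    ≡⟨ cong (λ i → fromℤ i * invFact i) (ℤ.suc-+ m (ℤ.- j)) ⟨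
  fromℤ (+ suc m ℤ.- j) * invFact (+ suc m ℤ.- j)            ≡⟨ cong (_* invFact (+ suc m ℤ.- j)) (fromℤ-- (+ suc m) j) ⟩
  (fromℕ (suc m) - fromℤ j) * invFact (+ suc m ℤ.- j)        ≡⟨ cong (λ x → (x - fromℤ j) * invFact (+ suc m ℤ.- j)) (fromℕ-suc m) ⟩
  (fromℕ m + 1ℚ - fromℤ j) * invFact (+ suc m ℤ.- j)         ∎

fact-invFact : ∀ n → fromℕ (n !) * invFact (+ n) ≡ 1ℚ
fact-invFact zero    = refl
fact-invFact (suc n) = begin
  fromℕ (suc n ℕ.* n !) * i  ≡⟨ cong (_* i) (fromℕ-* (suc n) (n !)) ⟩
  s * f * i                  ≡⟨ solve 3 (λ s f i → s :* f :* i := f :* (s :* i)) refl s f i ⟩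
  f * (s * i)                ≡⟨ cong (f *_) (invFact-suc (+ n)) ⟨
  f * invFact (+ n)          ≡⟨ fact-invFact n ⟩
  1ℚ                         ∎
  where
  i = invFact (+ suc n)
  s = fromℕ (suc n)
  f = fromℕ (n !)

suc-suc : ∀ a k → + suc a ℤ.- + suc k ≡ + a ℤ.- + k
suc-suc a k = trans (ℤ.m-n≡m⊖n (suc a) (suc k))
                    (trans (ℤ.[1+m]⊖[1+n]≡m⊖n a k) (sym (ℤ.m-n≡m⊖n a k)))

minus-pred : ∀ m j → + m ℤ.- ℤ.pred j ≡ + suc m ℤ.- j
minus-pred m j = begin
  + m ℤ.- (ℤ.- + 1 ℤ.+ j)          ≡⟨ cong (λ i → + m ℤ.+ i) (ℤ.neg-distrib-+ (ℤ.- + 1) j) ⟩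
  + m ℤ.+ (+ 1 ℤ.+ ℤ.- j)          ≡⟨ ℤ.+-assoc (+ m) (+ 1) (ℤ.- j) ⟨
  + m ℤ.+ + 1 ℤ.+ ℤ.- j            ≡⟨ cong (ℤ._+ ℤ.- j) (ℤ.+-comm (+ m) (+ 1)) ⟩
  + suc m ℤ.- j                    ∎

-- Pascal's rule: written over 1/(k + 1)! and 1/(a - k)!, the two summands carry the factors k + 1
-- and a - k, which add up to a + 1. For k > a both sides vanish, as `invFact` is 0 at negative
-- arguments.
C-invFact : ∀ a k → fromℕ (a C k) ≡ fromℕ (a !) * (invFact (+ k) * invFact (+ a ℤ.- + k))
C-invFact a zero = sym (begin
  f * (1ℚ * invFact (+ a ℤ.+ + 0))  ≡⟨ cong (f *_) (*-identityˡ (invFact (+ a ℤ.+ + 0))) ⟩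
  f * invFact (+ a ℤ.+ + 0)         ≡⟨ cong (λ i → f * invFact i) (ℤ.+-identityʳ (+ a)) ⟩
  f * invFact (+ a)                 ≡⟨ fact-invFact a ⟩
  1ℚ                                ∎)
  where f = fromℕ (a !)
C-invFact zero (suc k) = sym (trans (*-identityˡ _) (*-zeroʳ (invFact (+ suc k))))
C-invFact (suc a) (suc k) = begin
  fromℕ (suc a C suc k)                ≡⟨ cong fromℕ (nCk+nC[k+1]≡[n+1]C[k+1] a k) ⟨
  fromℕ (a C k ℕ.+ a C suc k)          ≡⟨ fromℕ-+ (a C k) (a C suc k) ⟩
  fromℕ (a C k) + fromℕ (a C suc k)    ≡⟨ cong₂ _+_ (C-invFact a k) (C-invFact a (suc k)) ⟩
  f * (invFact (+ k) * x) + f * (y * invFact (+ a ℤ.- + suc k))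
    ≡⟨ cong₂ (λ u v → f * (u * x) + f * (y * v)) (invFact-suc (+ k))
         (trans (cong invFact (ℤ.minus-suc (+ a) k)) (invFact-pred d)) ⟩
  f * (fromℕ (suc k) * y * x) + f * (y * (fromℤ d * x))
    ≡⟨ cong₂ (λ u v → f * (u * y * x) + f * (y * (v * x))) (fromℕ-suc k) (fromℤ-- (+ a) (+ k)) ⟩
  f * ((fromℕ k + 1ℚ) * y * x) + f * (y * ((fromℕ a - fromℕ k) * x))
    ≡⟨ solve 5 (λ f k a y x → f :* ((k :+ con (+ 1)) :* y :* x) :+ f :* (y :* ((a :- k) :* x))
                           := (a :+ con (+ 1)) :* f :* (y :* x)) refl f (fromℕ k) (fromℕ a) y x ⟩
  (fromℕ a + 1ℚ) * f * (y * x)         ≡⟨ cong (λ u → u * f * (y * x)) (fromℕ-suc a) ⟨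
  fromℕ (suc a) * f * (y * x)          ≡⟨ cong₂ (λ u i → u * (y * invFact i)) (fromℕ-* (suc a) (a !)) (suc-suc a k) ⟨
  fromℕ (suc a !) * (y * invFact (+ suc a ℤ.- + suc k)) ∎
  where
  d = + a ℤ.- + k
  f = fromℕ (a !)
  x = invFact d
  y = invFact (+ suc k)

binom-invFact : ∀ a j → fromℕ (binom a j) ≡ fromℕ (a !) * (invFact j * invFact (+ a ℤ.- j))
binom-invFact a (+ k)    = C-invFact a k
binom-invFact a -[1+ k ] = sym (trans (cong (fromℕ (a !) *_) (*-zeroˡ (invFact (+ a ℤ.- -[1+ k ])))) (*-zeroʳ (fromℕ (a !))))

-- The closed form of the coefficients.

facts : ℕ → ℕ → ℚ
facts t m = fromℕ ((m ℕ.+ t) !) * fromℕ (m !)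

invFacts : ℕ → ℕ → ℤ → ℚ
invFacts t m j = invFact (ℤ.suc j) * invFact j * (invFact (+ (m ℕ.+ t) ℤ.- j) * invFact (+ suc m ℤ.- j))

-- Takes rationals in place of t, m and j so that `termₚ` can copy its shape.
term : ℚ → ℚ → ℚ → ℚ → ℚ → ℚ
term t m j f b = (m + 1ℚ - j * t) * (f * b)

nbarCoeff : ℕ → ℕ → ℤ → ℚ
nbarCoeff t m j = term (fromℕ t) (fromℕ m) (fromℤ j) (facts t m) (invFacts t m j)

-- Over the reciprocal factorials of k + 1, k, m + t - k and m + 1 - k, the two products of
-- binomials have the factors (k + 1)(m + 1 - k) and (m + t - k)k, whose difference is m + 1 - kt.
Ncoeff≡nbarCoeff : ∀ t m k → fromℤ (Ncoeff (m ℕ.+ t) m k) ≡ nbarCoeff t m (+ k)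
Ncoeff≡nbarCoeff t m k = begin
  fromℤ (+ ((a C k) ℕ.* (m C k)) ℤ.- + ((a C suc k) ℕ.* binom m (k ⊖ 1)))
    ≡⟨ fromℤ-- (+ ((a C k) ℕ.* (m C k))) (+ ((a C suc k) ℕ.* binom m (k ⊖ 1))) ⟩
  fromℕ ((a C k) ℕ.* (m C k)) - fromℕ ((a C suc k) ℕ.* binom m (k ⊖ 1))
    ≡⟨ cong₂ _-_ (fromℕ-* (a C k) (m C k)) (fromℕ-* (a C suc k) (binom m (k ⊖ 1))) ⟩
  fromℕ (a C k) * fromℕ (m C k) - fromℕ (a C suc k) * fromℕ (binom m (k ⊖ 1))
    ≡⟨ cong₂ _-_ (cong₂ _*_ aCk mCk) (cong₂ _*_ aC[k+1] mC[k-1]) ⟩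
  f * ((K + 1ℚ) * y * x) * (g * (z * ((M + 1ℚ - K) * w))) - f * (y * ((M + T - K) * x)) * (g * (K * z * w))
    ≡⟨ solve 9 (λ f g x y z w M K T →
         f :* ((K :+ ♯1) :* y :* x) :* (g :* (z :* ((M :+ ♯1 :- K) :* w))) :- f :* (y :* ((M :+ T :- K) :* x)) :* (g :* (K :* z :* w))
         := (M :+ ♯1 :- K :* T) :* (f :* g :* (y :* z :* (x :* w)))) refl f g x y z w M K T ⟩
  nbarCoeff t m (+ k) ∎
  where
  ♯1 : ∀ {n} → Polynomial n
  ♯1 = con (+ 1)
  a = m ℕ.+ t
  f = fromℕ (a !)
  g = fromℕ (m !)
  M = fromℕ m
  K = fromℕ k
  T = fromℕ t
  x = invFact (+ a ℤ.- + k)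
  y = invFact (+ suc k)
  z = invFact (+ k)
  w = invFact (+ suc m ℤ.- + k)
  aCk : fromℕ (a C k) ≡ f * ((K + 1ℚ) * y * x)
  aCk = trans (C-invFact a k) (cong (λ u → f * (u * x))
          (trans (invFact-suc (+ k)) (cong (_* y) (fromℕ-suc k))))
  mCk : fromℕ (m C k) ≡ g * (z * ((M + 1ℚ - K) * w))
  mCk = trans (C-invFact m k) (cong (λ u → g * (z * u)) (invFact-minus m (+ k)))
  aC[k+1] : fromℕ (a C suc k) ≡ f * (y * ((M + T - K) * x))
  aC[k+1] = trans (C-invFact a (suc k)) (cong (λ u → f * (y * u)) (begin
    invFact (+ a ℤ.- + suc k)         ≡⟨ cong invFact (ℤ.minus-suc (+ a) k) ⟩
    invFact (ℤ.pred (+ a ℤ.- + k))    ≡⟨ invFact-pred (+ a ℤ.- + k) ⟩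
    fromℤ (+ a ℤ.- + k) * x           ≡⟨ cong (_* x) (fromℤ-- (+ a) (+ k)) ⟩
    (fromℕ a - K) * x                 ≡⟨ cong (λ u → (u - K) * x) (fromℕ-+ m t) ⟩
    (M + T - K) * x                   ∎))
  mC[k-1] : fromℕ (binom m (k ⊖ 1)) ≡ g * (K * z * w)
  mC[k-1] = begin
    -- For k = 0 the lower index is -1, and the factor K = 0 at the end of the chain accounts for
    -- it.
    fromℕ (binom m (k ⊖ 1))           ≡⟨ cong (fromℕ ∘ binom m) (trans (sym (ℤ.m-n≡m⊖n k 1)) (ℤ.+-comm (+ k) (ℤ.- + 1))) ⟩
    fromℕ (binom m (ℤ.pred (+ k)))    ≡⟨ binom-invFact m (ℤ.pred (+ k)) ⟩
    g * (invFact (ℤ.pred (+ k)) * invFact (+ m ℤ.- ℤ.pred (+ k)))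
      ≡⟨ cong₂ (λ u i → g * (u * invFact i)) (invFact-pred (+ k)) (minus-pred m (+ k)) ⟩
    g * (K * z * w) ∎

-- Past the end of the list `coeff` returns 0, hence the vanishing condition on f.
coeff-applyUpTo : ∀ f n → (∀ k → n ≤ k → f k ≡ 0ℚ) → ∀ k → coeff (applyUpTo f n) k ≡ f k
coeff-applyUpTo f zero    f≡0 k       = sym (f≡0 k z≤n)
coeff-applyUpTo f (suc n) f≡0 zero    = refl
coeff-applyUpTo f (suc n) f≡0 (suc k) = coeff-applyUpTo (f ∘ suc) n (λ j n≤j → f≡0 (suc j) (s≤s n≤j)) k

Ncoeff-> : ∀ n m k → n ℕ.< k → Ncoeff n m k ≡ + 0
Ncoeff-> n m k n<k = cong₂ (λ x y → + (x ℕ.* (m C k)) ℤ.- + (y ℕ.* binom m (k ⊖ 1)))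
                           (k>n⇒nCk≡0 n<k) (k>n⇒nCk≡0 (ℕ.m<n⇒m<1+n n<k))

coeff-Nbar : ∀ t m k → coeff (Nbar t m) k ≡ nbarCoeff t m (+ k)
coeff-Nbar t m k = trans
  (coeff-applyUpTo (fromℤ ∘ Ncoeff (m ℕ.+ t) m) (suc (m ℕ.+ t))
                   (λ j m+t<j → cong fromℤ (Ncoeff-> (m ℕ.+ t) m j m+t<j)) k)
  (Ncoeff≡nbarCoeff t m k)

nbarCoeff-neg : ∀ t m k → nbarCoeff t m -[1+ k ] ≡ 0ℚ
nbarCoeff-neg t m k =
  -- The solver's constant 0 is what `invFact -[1+ k ]` reduces to.
  solve 5 (λ x f y z w → x :* (f :* (y :* con (+ 0) :* (z :* w))) := con (+ 0)) refl
    (fromℕ m + 1ℚ - fromℤ -[1+ k ] * fromℕ t) (facts t m) (invFact (ℤ.suc -[1+ k ]))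
    (invFact (+ (m ℕ.+ t) ℤ.- -[1+ k ])) (invFact (+ suc m ℤ.- -[1+ k ]))

-- Polynomials acting on two-sided sequences.

-- Polynomials act on two-sided sequences of coefficients, x acting as the
-- shift; on ℤ the shift needs no case distinction at 0.
infixr 7 _·_
_·_ : Poly → (ℤ → ℚ) → ℤ → ℚ
([]      · f) j = 0ℚ
((a ∷ p) · f) j = a * f j + (p · f) (ℤ.pred j)

·-cong : ∀ p {f g} → f ≗ g → p · f ≗ p · g
·-cong []      f≗g j = refl
·-cong (a ∷ p) f≗g j = cong₂ (λ x y → a * x + y) (f≗g j) (·-cong p f≗g (ℤ.pred j))

·-+ₚ : ∀ p q f j → ((p +ₚ q) · f) j ≡ (p · f) j + (q · f) j
·-+ₚ []      q       f j = sym (+-identityˡ ((q · f) j))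
·-+ₚ (a ∷ p) []      f j = sym (+-identityʳ (((a ∷ p) · f) j))
·-+ₚ (a ∷ p) (b ∷ q) f j = trans
  (cong (λ y → (a + b) * f j + y) (·-+ₚ p q f (ℤ.pred j)))
  (solve 5 (λ a b x y z → (a :+ b) :* x :+ (y :+ z) := (a :* x :+ y) :+ (b :* x :+ z)) refl
    a b (f j) ((p · f) (ℤ.pred j)) ((q · f) (ℤ.pred j)))

·-scale : ∀ c p f j → (scale c p · f) j ≡ c * (p · f) j
·-scale c []      f j = sym (*-zeroʳ c)
·-scale c (a ∷ p) f j = trans
  (cong (λ y → c * a * f j + y) (·-scale c p f (ℤ.pred j)))
  (solve 4 (λ c a x y → c :* a :* x :+ c :* y := c :* (a :* x :+ y)) refl
    c a (f j) ((p · f) (ℤ.pred j)))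

·-neg : ∀ p f j → (map (-_) p · f) j ≡ - (p · f) j
·-neg []      f j = refl
·-neg (a ∷ p) f j = trans
  (cong (λ y → - a * f j + y) (·-neg p f (ℤ.pred j)))
  (solve 3 (λ a x y → :- a :* x :+ :- y := :- (a :* x :+ y)) refl a (f j) ((p · f) (ℤ.pred j)))

·--ₚ : ∀ p q f j → ((p -ₚ q) · f) j ≡ (p · f) j - (q · f) j
·--ₚ p q f j = trans (·-+ₚ p (map (-_) q) f j) (cong (λ y → (p · f) j + y) (·-neg q f j))

-- The `0ℚ ∷_` in the definition of `_*ₚ_` is the step to `ℤ.pred j`. Products thereby become
-- iterated actions.
·-*ₚ : ∀ p q f → (p *ₚ q) · f ≗ p · q · f
·-*ₚ []      q f j = refl
·-*ₚ (a ∷ p) q f j = begin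
  ((scale a q +ₚ (0ℚ ∷ (p *ₚ q))) · f) j      ≡⟨ ·-+ₚ (scale a q) (0ℚ ∷ (p *ₚ q)) f j ⟩
  (scale a q · f) j + (0ℚ * f j + ((p *ₚ q) · f) (ℤ.pred j))
    ≡⟨ cong₂ (λ x y → x + (0ℚ * f j + y)) (·-scale a q f j) (·-*ₚ p q f (ℤ.pred j)) ⟩
  a * (q · f) j + (0ℚ * f j + (p · q · f) (ℤ.pred j))
    ≡⟨ cong (λ y → a * (q · f) j + y) (trans (cong (_+ (p · q · f) (ℤ.pred j)) (*-zeroˡ (f j))) (+-identityˡ _)) ⟩
  a * (q · f) j + (p · q · f) (ℤ.pred j)      ∎

·-linear : ∀ p a b f g j → (p · λ i → a * f i + b * g i) j ≡ a * (p · f) j + b * (p · g) j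
·-linear []      a b f g j = solve 2 (λ a b → con (+ 0) := a :* con (+ 0) :+ b :* con (+ 0)) refl a b
·-linear (c ∷ p) a b f g j = trans
  (cong (λ y → c * (a * f j + b * g j) + y) (·-linear p a b f g (ℤ.pred j)))
  (solve 7 (λ a b c x y z w → c :* (a :* x :+ b :* y) :+ (a :* z :+ b :* w)
                            := a :* (c :* x :+ z) :+ b :* (c :* y :+ w)) refl
    a b c (f j) (g j) ((p · f) (ℤ.pred j)) ((p · g) (ℤ.pred j)))

·-shift : ∀ p f j → (p · f ∘ ℤ.pred) j ≡ (p · f) (ℤ.pred j)
·-shift []      f j = refl
·-shift (a ∷ p) f j = cong (λ y → a * f (ℤ.pred j) + y) (·-shift p f (ℤ.pred j))

-- The action of q is linear and commutes with the shift, and p acts by a linear combination of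
-- iterated shifts; induction on p combines these.
·-comm : ∀ p q f → p · q · f ≗ q · p · f
·-comm []      q f j = sym (zero-· q j)
  where
  zero-· : ∀ q → q · ([] · f) ≗ λ _ → 0ℚ
  zero-· []      j = refl
  zero-· (b ∷ q) j = trans (cong₂ _+_ (*-zeroʳ b) (zero-· q (ℤ.pred j))) (+-identityˡ 0ℚ)
·-comm (a ∷ p) q f j = begin
  a * (q · f) j + (p · q · f) (ℤ.pred j)             ≡⟨ cong (λ y → a * (q · f) j + y) (·-comm p q f (ℤ.pred j)) ⟩
  a * (q · f) j + (q · p · f) (ℤ.pred j)             ≡⟨ cong (λ y → a * (q · f) j + y) (·-shift q (p · f) j) ⟨
  a * (q · f) j + (q · (p · f) ∘ ℤ.pred) j           ≡⟨ cong (λ y → a * (q · f) j + y) (*-identityˡ _) ⟨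
  a * (q · f) j + 1ℚ * (q · (p · f) ∘ ℤ.pred) j      ≡⟨ ·-linear q a 1ℚ f ((p · f) ∘ ℤ.pred) j ⟨
  (q · λ i → a * f i + 1ℚ * (p · f) (ℤ.pred i)) j    ≡⟨ ·-cong q (λ i → cong (λ y → a * f i + y) (*-identityˡ _)) j ⟩
  (q · (a ∷ p) · f) j                                ∎

·-- : ∀ p f g j → (p · λ i → f i - g i) j ≡ (p · f) j - (p · g) j
·-- p f g j = begin
  (p · λ i → f i - g i) j                 ≡⟨ ·-cong p (λ i → minus (f i) (g i)) j ⟩
  (p · λ i → 1ℚ * f i + - 1ℚ * g i) j     ≡⟨ ·-linear p 1ℚ (- 1ℚ) f g j ⟩
  1ℚ * (p · f) j + - 1ℚ * (p · g) j       ≡⟨ minus ((p · f) j) ((p · g) j) ⟨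
  (p · f) j - (p · g) j                   ∎
  where
  minus : ∀ x y → x - y ≡ 1ℚ * x + - 1ℚ * y
  minus = solve 2 (λ x y → x :- y := con (+ 1) :* x :+ :- con (+ 1) :* y) refl

·-const : ∀ c f j → (const c · f) j ≡ c * f j
·-const c f j = +-identityʳ (c * f j)

·-const1 : ∀ f → const 1ℚ · f ≗ f
·-const1 f j = trans (·-const 1ℚ f j) (*-identityˡ (f j))

-- Coefficient sequences and clearing of denominators.

δ : ℤ → ℚ
δ (+ zero)  = 1ℚ
δ (+ suc _) = 0ℚ
δ -[1+ _ ]  = 0ℚ

·δ-neg : ∀ p k → (p · δ) -[1+ k ] ≡ 0ℚ
·δ-neg []      k = refl
·δ-neg (a ∷ p) k = trans (cong₂ _+_ (*-zeroʳ a) (·δ-neg p (suc k))) (+-identityˡ 0ℚ)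

-- `δ` is the coefficient sequence of the polynomial 1, so p acting on it gives back p. This moves
-- between `_≈ₚ_` and identities of sequences on ℤ.
·δ-coeff : ∀ p k → (p · δ) (+ k) ≡ coeff p k
·δ-coeff []      k       = refl
·δ-coeff (a ∷ p) zero    = trans (cong₂ _+_ (*-identityʳ a) (·δ-neg p 0)) (+-identityʳ a)
·δ-coeff (a ∷ p) (suc k) = trans (cong₂ _+_ (*-zeroʳ a) (·δ-coeff p k)) (+-identityˡ (coeff p k))

-- Negative indices count too, since shifts by up to three places go below 0; there the closed form
-- vanishes with `invFact j`.
Nbar·δ : ∀ t m → Nbar t m · δ ≗ nbarCoeff t m
Nbar·δ t m (+ k)    = trans (·δ-coeff (Nbar t m) k) (coeff-Nbar t m k)
Nbar·δ t m -[1+ k ] = trans (·δ-neg (Nbar t m) k) (sym (nbarCoeff-neg t m k))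

-- Unfolding the fraction operations turns the claim into N₂ D² = (A N₁ - B N₀) D up to factors 1,
-- which is D times the recurrence.
clear-denominators : ∀ D D≉0 A B N₀ N₁ N₂ →
  D · N₂ · δ ≗ (λ j → (A · N₁ · δ) j - (B · N₀ · δ) j) →
  fromPoly N₂ ≈ᶠ frac A D D≉0 *ᶠ fromPoly N₁ -ᶠ frac B D D≉0 *ᶠ fromPoly N₀
clear-denominators D D≉0 A B N₀ N₁ N₂ recurrence k =
  trans (sym (·δ-coeff (N₂ *ₚ (D′ *ₚ D′)) k))
        (trans (cross-multiplied (+ k)) (·δ-coeff ((A *ₚ N₁ *ₚ D′ -ₚ B *ₚ N₀ *ₚ D′) *ₚ const 1ℚ) k))
  where
  open SetoidReasoning (ℤ →-setoid ℚ) renaming (begin_ to begin≗_; _∎ to _∎≗)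

  -- The form in which `_*ᶠ_` with `fromPoly` yields the denominator; it acts as D does.
  D′ : Poly
  D′ = D *ₚ const 1ℚ

  D′· : ∀ f → D′ · f ≗ D · f
  D′· f j = trans (·-*ₚ D (const 1ℚ) f j) (·-cong D (·-const1 f) j)

  side : ∀ U N → D′ · U · N · δ ≗ (U *ₚ N *ₚ D′) · δ
  side U N = begin≗
    D′ · U · N · δ         ≈⟨ ·-cong D′ (·-*ₚ U N δ) ⟨
    D′ · (U *ₚ N) · δ      ≈⟨ ·-comm D′ (U *ₚ N) δ ⟩
    (U *ₚ N) · D′ · δ      ≈⟨ ·-*ₚ (U *ₚ N) D′ δ ⟨
    (U *ₚ N *ₚ D′) · δ     ∎≗

  cross-multiplied : (N₂ *ₚ (D′ *ₚ D′)) · δ ≗ ((A *ₚ N₁ *ₚ D′ -ₚ B *ₚ N₀ *ₚ D′) *ₚ const 1ℚ) · δ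
  cross-multiplied = begin≗
    (N₂ *ₚ (D′ *ₚ D′)) · δ                           ≈⟨ ·-*ₚ N₂ (D′ *ₚ D′) δ ⟩
    N₂ · (D′ *ₚ D′) · δ                              ≈⟨ ·-comm N₂ (D′ *ₚ D′) δ ⟩
    (D′ *ₚ D′) · N₂ · δ                              ≈⟨ ·-*ₚ D′ D′ (N₂ · δ) ⟩
    -- The inner `D′` becomes D to meet the recurrence; the outer one stays as the extra factor.
    D′ · D′ · N₂ · δ                                 ≈⟨ ·-cong D′ (λ j → trans (D′· (N₂ · δ) j) (recurrence j)) ⟩
    D′ · (λ j → (A · N₁ · δ) j - (B · N₀ · δ) j)     ≈⟨ ·-- D′ (A · N₁ · δ) (B · N₀ · δ) ⟩
    (λ j → (D′ · A · N₁ · δ) j - (D′ · B · N₀ · δ) j) ≈⟨ (λ j → cong₂ _-_ (side A N₁ j) (side B N₀ j)) ⟩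
    (λ j → ((A *ₚ N₁ *ₚ D′) · δ) j - ((B *ₚ N₀ *ₚ D′) · δ) j) ≈⟨ ·--ₚ (A *ₚ N₁ *ₚ D′) (B *ₚ N₀ *ₚ D′) δ ⟨
    (A *ₚ N₁ *ₚ D′ -ₚ B *ₚ N₀ *ₚ D′) · δ             ≈⟨ ·-cong (A *ₚ N₁ *ₚ D′ -ₚ B *ₚ N₀ *ₚ D′) (·-const1 δ) ⟨
    (A *ₚ N₁ *ₚ D′ -ₚ B *ₚ N₀ *ₚ D′) · const 1ℚ · δ  ≈⟨ ·-*ₚ (A *ₚ N₁ *ₚ D′ -ₚ B *ₚ N₀ *ₚ D′) (const 1ℚ) δ ⟨
    ((A *ₚ N₁ *ₚ D′ -ₚ B *ₚ N₀ *ₚ D′) *ₚ const 1ℚ) · δ ∎≗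

-- Ratios of neighbouring hypergeometric terms.

facts-suc : ∀ t m → facts t (suc m) ≡ (fromℕ m + fromℕ t + 1ℚ) * (fromℕ m + 1ℚ) * facts t m
facts-suc t m = begin
  fromℕ (suc (m ℕ.+ t) ℕ.* (m ℕ.+ t) !) * fromℕ (suc m ℕ.* m !)
    ≡⟨ cong₂ _*_ (fromℕ-* (suc (m ℕ.+ t)) ((m ℕ.+ t) !)) (fromℕ-* (suc m) (m !)) ⟩
  fromℕ (suc (m ℕ.+ t)) * f * (fromℕ (suc m) * g)
    ≡⟨ cong₂ (λ x y → x * f * (y * g))
         (trans (fromℕ-suc (m ℕ.+ t)) (cong (_+ 1ℚ) (fromℕ-+ m t))) (fromℕ-suc m) ⟩
  (fromℕ m + fromℕ t + 1ℚ) * f * ((fromℕ m + 1ℚ) * g)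
    ≡⟨ solve 4 (λ x y f g → x :* f :* (y :* g) := x :* y :* (f :* g)) refl
         (fromℕ m + fromℕ t + 1ℚ) (fromℕ m + 1ℚ) f g ⟩
  (fromℕ m + fromℕ t + 1ℚ) * (fromℕ m + 1ℚ) * (f * g) ∎
  where
  f = fromℕ ((m ℕ.+ t) !)
  g = fromℕ (m !)

-- Lowering j raises m + t - j and m + 1 - j by one, just as raising m does; the other two
-- factorials contribute j + 1 and j.
invFacts-pred : ∀ t m j → invFacts t m (ℤ.pred j) ≡ (fromℤ j + 1ℚ) * fromℤ j * invFacts t (suc m) j
invFacts-pred t m j = begin
  invFact (ℤ.suc (ℤ.pred j)) * invFact (ℤ.pred j) * (invFact (+ (m ℕ.+ t) ℤ.- ℤ.pred j) * invFact (+ suc m ℤ.- ℤ.pred j))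
    ≡⟨ cong₂ (λ x y → invFact x * invFact (ℤ.pred j) * y) (ℤ.suc-pred j)
         (cong₂ (λ x y → invFact x * invFact y) (minus-pred (m ℕ.+ t) j) (minus-pred (suc m) j)) ⟩
  invFact j * invFact (ℤ.pred j) * c
    ≡⟨ cong₂ (λ x y → x * y * c) (trans (invFact-suc j) (cong (_* a) (fromℤ-suc j))) (invFact-pred j) ⟩
  (fromℤ j + 1ℚ) * a * (fromℤ j * b) * c
    ≡⟨ solve 5 (λ x a j b c → x :* a :* (j :* b) :* c := x :* j :* (a :* b :* c)) refl (fromℤ j + 1ℚ) a (fromℤ j) b c ⟩
  (fromℤ j + 1ℚ) * fromℤ j * (a * b * c) ∎
  where
  a = invFact (ℤ.suc j)
  b = invFact j
  c = invFact (+ (suc m ℕ.+ t) ℤ.- j) * invFact (+ suc (suc m) ℤ.- j)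

-- Raising m leaves (j + 1)! and j! alone. With `invFacts-pred` this makes every `invFacts` that
-- occurs a polynomial multiple of a single one, at a larger m and the unshifted j.
invFacts-suc : ∀ t m j → invFacts t m j ≡
  (fromℕ m + fromℕ t + 1ℚ - fromℤ j) * (fromℕ m + 1ℚ + 1ℚ - fromℤ j) * invFacts t (suc m) j
invFacts-suc t m j = begin
  a * (invFact (+ (m ℕ.+ t) ℤ.- j) * invFact (+ suc m ℤ.- j))
    ≡⟨ cong₂ (λ x y → a * (x * y)) (invFact-minus (m ℕ.+ t) j) (invFact-minus (suc m) j) ⟩
  a * ((fromℕ (m ℕ.+ t) + 1ℚ - fromℤ j) * b * ((fromℕ (suc m) + 1ℚ - fromℤ j) * c))
    ≡⟨ cong₂ (λ x y → a * ((x + 1ℚ - fromℤ j) * b * ((y + 1ℚ - fromℤ j) * c))) (fromℕ-+ m t) (fromℕ-suc m) ⟩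
  a * (x * b * (y * c))
    ≡⟨ solve 5 (λ a b c x y → a :* (x :* b :* (y :* c)) := x :* y :* (a :* (b :* c))) refl a b c x y ⟩
  x * y * (a * (b * c)) ∎
  where
  a = invFact (ℤ.suc j) * invFact j
  b = invFact (+ (suc m ℕ.+ t) ℤ.- j)
  c = invFact (+ suc (suc m) ℤ.- j)
  x = fromℕ m + fromℕ t + 1ℚ - fromℤ j
  y = fromℕ m + 1ℚ + 1ℚ - fromℤ j

-- The recurrence as a polynomial identity in five variables.

-- The variable s = t/2 keeps the coefficients integral. The digits of b_{di}
-- refer to invFacts at n₀ + d and k - i, the common multiple being b f₀ with
-- b = invFacts at n₀ + 3 and k. Listing f₀ and b first keeps the Horner normal
-- forms small.
module Symbolic where

  Pol : Set
  Pol = Polynomial 5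

  ♯_ : ℕ → Pol
  ♯ i = con (+ i)

  f₀ b k s t n₀ n n₂ k₁ k₂ k₃ : Pol
  f₀ = var 0F
  b  = var 1F
  k  = var 2F
  s  = var 3F
  n₀ = var 4F
  t  = s :+ s
  n  = n₀ :+ ♯ 1
  n₂ = n :+ ♯ 1
  k₁ = k :- ♯ 1
  k₂ = k₁ :- ♯ 1
  k₃ = k₂ :- ♯ 1

  α₀ α₁ α₂ β₀ β₁ γ₀ γ₁ : Pol
  α₀ = :- (♯ 2 :* n :+ ♯ 3) :* (n :+ t) :* (n :+ t :+ ♯ 1)
  -- Here 3t/2 is 3s; in `α₂`, `β₁` and `γ₁`, t²/2 is s t.
  α₁ = ♯ 3 :* s :* (t :- ♯ 2) :* (t :+ ♯ 1) :^ 2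
     :+ t :* (t :- ♯ 2) :* (t :^ 2 :+ ♯ 7 :* t :+ ♯ 5) :* n
     :+ ♯ 3 :* t :* (t :- ♯ 2) :* (t :+ ♯ 2) :* n :^ 2
     :+ ♯ 2 :* t :* (t :- ♯ 2) :* n :^ 3
  α₂ = s :* t :* (t :- ♯ 1) :* (t :+ ♯ 1) :^ 2
     :+ (t :- ♯ 1) :* (♯ 2 :* t :^ 3 :+ ♯ 3 :* t :^ 2 :+ t :- ♯ 3) :* n
     :+ (t :- ♯ 1) :* (♯ 3 :* t :^ 2 :+ ♯ 3 :* t :- ♯ 5) :* n :^ 2
     :+ ♯ 2 :* (t :- ♯ 1) :^ 2 :* n :^ 3
  β₀ = :- n :- ♯ 1 :- t
  β₁ = (t :- ♯ 1) :^ 2 :* n :+ s :* (t :- ♯ 1) :* t :+ (t :- ♯ 1) :^ 2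
  γ₀ = :- n :- t
  γ₁ = (t :- ♯ 1) :^ 2 :* n :+ s :* (t :- ♯ 1) :* t

  factsSuc invFactsSuc invFactsPred : Pol → Pol → Pol
  factsSuc m f = (m :+ t :+ ♯ 1) :* (m :+ ♯ 1) :* f
  invFactsSuc m x = (m :+ t :+ ♯ 1 :- k) :* (m :+ ♯ 1 :+ ♯ 1 :- k) :* x
  invFactsPred j x = (j :+ ♯ 1) :* j :* x

  -- A b_{di} with i > 0 comes from b_{d+1,i-1} by a shift, a b_{d0} from b_{d+1,0}, where b_{30} is
  -- b; so `invFactsSuc` is only ever applied at the index k.
  f₁ f₂ b₂₀ b₂₁ b₁₀ b₁₁ b₁₂ b₀₀ b₀₁ b₀₂ b₀₃ : Pol
  f₁  = factsSuc n₀ f₀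
  f₂  = factsSuc n f₁
  b₂₀ = invFactsSuc n₂ b
  b₂₁ = invFactsPred k b
  b₁₀ = invFactsSuc n b₂₀
  b₁₁ = invFactsPred k b₂₀
  b₁₂ = invFactsPred k₁ b₂₁
  b₀₀ = invFactsSuc n₀ b₁₀
  b₀₁ = invFactsPred k b₁₀
  b₀₂ = invFactsPred k₁ b₁₁
  b₀₃ = invFactsPred k₂ b₁₂

  termₚ : Pol → Pol → Pol → Pol → Pol
  termₚ m j f x = (m :+ ♯ 1 :- j :* t) :* (f :* x)

  -- The actions of c, c + dx and c + dx + ex² in the shape to which _·_ reduces.
  act₁ : Pol → Pol → Pol
  act₁ c u₀ = c :* u₀ :+ ♯ 0

  act₂ : Pol → Pol → Pol → Pol → Pol
  act₂ c d u₀ u₁ = c :* u₀ :+ act₁ d u₁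

  act₃ : Pol → Pol → Pol → Pol → Pol → Pol → Pol
  act₃ c d e u₀ u₁ u₂ = c :* u₀ :+ act₂ d e u₁ u₂

  lhs : (γ₀ γ₁ n t x₀ x₁ : Pol) → Pol
  lhs γ₀ γ₁ n t x₀ x₁ = act₁ ((n :+ t :+ ♯ 1) :* (n :+ ♯ 3)) (act₂ γ₀ γ₁ x₀ x₁)

  -- The square (x - 1)² acts as x - 1 twice, so the action of b₀ + b₁x is taken at the three
  -- indices k, k - 1 and k - 2.
  rhs : (α₀ α₁ α₂ β₀ β₁ n t y₀ y₁ y₂ z₀ z₁ z₂ z₃ : Pol) → Pol
  rhs α₀ α₁ α₂ β₀ β₁ n t y₀ y₁ y₂ z₀ z₁ z₂ z₃ =
    act₃ α₀ α₁ α₂ y₀ y₁ y₂ :- act₁ (n :* (n :+ t)) (act₂ m (♯ 1) (act₂ m (♯ 1) w₀ w₁) (act₂ m (♯ 1) w₁ w₂))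
    where
    -- `X -ₚ const 1ℚ` reduces to the list with entries -1 and 1.
    m = con (ℤ.- + 1)
    w₀ = act₂ β₀ β₁ z₀ z₁
    w₁ = act₂ β₀ β₁ z₁ z₂
    w₂ = act₂ β₀ β₁ z₂ z₃

  left right : Pol
  left  = lhs γ₀ γ₁ n t (termₚ n₂ k f₂ b₂₀) (termₚ n₂ k₁ f₂ b₂₁)
  right = rhs α₀ α₁ α₂ β₀ β₁ n t
            (termₚ n k f₁ b₁₀) (termₚ n k₁ f₁ b₁₁) (termₚ n k₂ f₁ b₁₂)
            (termₚ n₀ k f₀ b₀₀) (termₚ n₀ k₁ f₀ b₀₁) (termₚ n₀ k₂ f₀ b₀₂) (termₚ n₀ k₃ f₀ b₀₃)

  -- Both sides have the same Horner normal form. Here f₀ and b are free variables, since the ratios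
  -- of all other factorial products to them are already polynomials.
  left≡right : ∀ ρ → ⟦ left ⟧ ρ ≡ ⟦ right ⟧ ρ
  left≡right ρ = prove ρ left right refl

-- Matching rational values with symbolic expressions.

module Evaluation (f₀ b k s n₀ : ℚ) where

  private module S = Symbolic
  open Symbolic using (Pol)

  ρ : Vec ℚ 5
  ρ = f₀ ∷ b ∷ k ∷ s ∷ n₀ ∷ []

  -- A record, so that p can be inferred from x ↦ p.
  infix 4 _↦_
  record _↦_ (x : ℚ) (p : Pol) : Set where
    constructor by
    field value : x ≡ ⟦ p ⟧ ρ

  open _↦_ public

  ½[t-1]t² : ½ * (s + s - 1ℚ) * (s + s) ^ 2 ≡ s * (s + s - 1ℚ) * (s + s)
  ½[t-1]t² = trans
    -- `½` enters as the variable h because the solver has integer coefficients; h + h then computes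
    -- to 1.
    (solve 2 (λ h s → let t = s :+ s in
        h :* (t :- con (+ 1)) :* t :^ 2 := (h :+ h) :* s :* (t :- con (+ 1)) :* t) refl ½ s)
    (cong (λ x → x * (s + s - 1ℚ) * (s + s)) (*-identityˡ s))

  -- The first summand is the only place where `a₁` and `a₂` hold a fraction; the others agree by
  -- computation.
  in-first-summand : ∀ {x y p q u v w} → x ≡ y → x * p * q + u + v + w ≡ y * p * q + u + v + w
  in-first-summand refl = refl

  -- With t and n as variables, matching `refl` replaces them by the values of their expressions,
  -- and the rest is computation.
  a₀↦ : ∀ {t n} → t ↦ S.t → n ↦ S.n → a₀ t n ↦ S.α₀
  a₀↦ (by refl) (by refl) = by refl

  a₁↦ : ∀ {t n} → t ↦ S.t → n ↦ S.n → a₁ t n ↦ S.α₁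
  a₁↦ (by refl) (by refl) = by $ in-first-summand
    -- At h = ½ the coefficient 3h computes to `+ 3 / 2`, and 3(h + h) to 3.
    (solve 2 (λ h s → con (+ 3) :* h :* (s :+ s) := con (+ 3) :* (h :+ h) :* s) refl ½ s)

  a₂↦ : ∀ {t n} → t ↦ S.t → n ↦ S.n → a₂ t n ↦ S.α₂
  a₂↦ (by refl) (by refl) = by $ in-first-summand (trans
    (solve 2 (λ h s → h :* (s :+ s) :^ 2 := (h :+ h) :* s :* (s :+ s)) refl ½ s)
    (cong (_* (s + s)) (*-identityˡ s)))

  b₀↦ : ∀ {t n} → t ↦ S.t → n ↦ S.n → b₀ t n ↦ S.β₀
  b₀↦ (by refl) (by refl) = by refl

  b₁↦ : ∀ {t n} → t ↦ S.t → n ↦ S.n → b₁ t n ↦ S.β₁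
  b₁↦ (by refl) (by refl) = by $
    cong (λ x → (s + s - 1ℚ) ^ 2 * (n₀ + 1ℚ) + x + (s + s - 1ℚ) ^ 2) ½[t-1]t²

  c₀↦ : ∀ {t n} → t ↦ S.t → n ↦ S.n → c₀ t n ↦ S.γ₀
  c₀↦ (by refl) (by refl) = by refl

  c₁↦ : ∀ {t n} → t ↦ S.t → n ↦ S.n → c₁ t n ↦ S.γ₁
  c₁↦ (by refl) (by refl) = by $ cong (λ x → (s + s - 1ℚ) ^ 2 * (n₀ + 1ℚ) + x) ½[t-1]t²

  factsSuc↦ : ∀ {t m m′ f f′ g} → t ↦ S.t → m ↦ m′ → f ↦ f′ →
    g ≡ (m + t + 1ℚ) * (m + 1ℚ) * f → g ↦ S.factsSuc m′ f′
  factsSuc↦ (by refl) (by refl) (by refl) eq = by eq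

  invFactsSuc↦ : ∀ {t m m′ x x′ y} → t ↦ S.t → m ↦ m′ → x ↦ x′ →
    y ≡ (m + t + 1ℚ - k) * (m + 1ℚ + 1ℚ - k) * x → y ↦ S.invFactsSuc m′ x′
  invFactsSuc↦ (by refl) (by refl) (by refl) eq = by eq

  invFactsPred↦ : ∀ {j j′ x x′ y} → j ↦ j′ → x ↦ x′ →
    y ≡ (j + 1ℚ) * j * x → y ↦ S.invFactsPred j′ x′
  invFactsPred↦ (by refl) (by refl) eq = by eq

  term↦ : ∀ {t m m′ j j′ f f′ x x′} → t ↦ S.t → m ↦ m′ → j ↦ j′ → f ↦ f′ → x ↦ x′ →
    term t m j f x ↦ S.termₚ m′ j′ f′ x′
  term↦ (by refl) (by refl) (by refl) (by refl) (by refl) = by refl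

  act : ℚ → ℚ → ℚ → ℚ → ℚ
  act c d u v = c * u + (d * v + 0ℚ)

  lhs↦ : ∀ {n n′ t t′ c₀ c₀′ c₁ c₁′ x₀ x₀′ x₁ x₁′} →
    c₀ ↦ c₀′ → c₁ ↦ c₁′ → n ↦ n′ → t ↦ t′ → x₀ ↦ x₀′ → x₁ ↦ x₁′ →
    (n + t + 1ℚ) * (n + fromℕ 3) * act c₀ c₁ x₀ x₁ + 0ℚ ↦ S.lhs c₀′ c₁′ n′ t′ x₀′ x₁′
  lhs↦ (by refl) (by refl) (by refl) (by refl) (by refl) (by refl) = by refl

  rhs↦ : ∀ {n n′ t t′ a₀ a₀′ a₁ a₁′ a₂ a₂′ b₀ b₀′ b₁ b₁′ y₀ y₀′ y₁ y₁′ y₂ y₂′ z₀ z₀′ z₁ z₁′ z₂ z₂′ z₃ z₃′} →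
    a₀ ↦ a₀′ → a₁ ↦ a₁′ → a₂ ↦ a₂′ → b₀ ↦ b₀′ → b₁ ↦ b₁′ → n ↦ n′ → t ↦ t′ →
    y₀ ↦ y₀′ → y₁ ↦ y₁′ → y₂ ↦ y₂′ → z₀ ↦ z₀′ → z₁ ↦ z₁′ → z₂ ↦ z₂′ → z₃ ↦ z₃′ →
    let w₀ = act b₀ b₁ z₀ z₁
        w₁ = act b₀ b₁ z₁ z₂
        w₂ = act b₀ b₁ z₂ z₃
    in a₀ * y₀ + act a₁ a₂ y₁ y₂ - (n * (n + t) * act (- 1ℚ) 1ℚ (act (- 1ℚ) 1ℚ w₀ w₁) (act (- 1ℚ) 1ℚ w₁ w₂) + 0ℚ)
         ↦ S.rhs a₀′ a₁′ a₂′ b₀′ b₁′ n′ t′ y₀′ y₁′ y₂′ z₀′ z₁′ z₂′ z₃′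
  rhs↦ (by refl) (by refl) (by refl) (by refl) (by refl) (by refl) (by refl) (by refl) (by refl) (by refl) (by refl) (by refl) (by refl) (by refl) = by refl

-- The recurrence for the closed form and the theorem.

nbarCoeff-recurrence : ∀ t p →
  let t′ = fromℕ t
      n′ = fromℕ (suc p)
  in denominator t′ n′ · nbarCoeff t (suc (suc p)) ≗ λ j →
       ((a₀ t′ n′ ∷ a₁ t′ n′ ∷ a₂ t′ n′ ∷ []) · nbarCoeff t (suc p)) j
       - ((const (n′ * (n′ + t′)) *ₚ ((X -ₚ const 1ℚ) *ₚ (X -ₚ const 1ℚ)) *ₚ (b₀ t′ n′ ∷ b₁ t′ n′ ∷ []))
            · nbarCoeff t p) j
nbarCoeff-recurrence t p j = begin
  (denominator t′ n′ · nbarCoeff t (suc n)) j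
    ≡⟨ ·-*ₚ (const ((n′ + t′ + 1ℚ) * (n′ + fromℕ 3))) (c₀ t′ n′ ∷ c₁ t′ n′ ∷ []) (nbarCoeff t (suc n)) j ⟩
  (const ((n′ + t′ + 1ℚ) * (n′ + fromℕ 3)) · (c₀ t′ n′ ∷ c₁ t′ n′ ∷ []) · nbarCoeff t (suc n)) j
    -- With products unfolded into iterated actions, both sides are values at `ρ` and are joined by
    -- the polynomial identity.
    ≡⟨ trans (value left↦) (trans (left≡right ρ) (sym (value right↦))) ⟩
  (A · nbarCoeff t n) j - (const N · (X-1 · X-1 · B · nbarCoeff t p)) j
    ≡⟨ cong (λ y → (A · nbarCoeff t n) j - y) (begin
         ((const N *ₚ (X-1 *ₚ X-1) *ₚ B) · nbarCoeff t p) j       ≡⟨ ·-*ₚ (const N *ₚ (X-1 *ₚ X-1)) B (nbarCoeff t p) j ⟩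
         ((const N *ₚ (X-1 *ₚ X-1)) · B · nbarCoeff t p) j        ≡⟨ ·-*ₚ (const N) (X-1 *ₚ X-1) (B · nbarCoeff t p) j ⟩
         (const N · (X-1 *ₚ X-1) · B · nbarCoeff t p) j           ≡⟨ ·-cong (const N) (·-*ₚ X-1 X-1 (B · nbarCoeff t p)) j ⟩
         (const N · X-1 · X-1 · B · nbarCoeff t p) j              ∎) ⟨
  (A · nbarCoeff t n) j - ((const N *ₚ (X-1 *ₚ X-1) *ₚ B) · nbarCoeff t p) j ∎
  where
  n = suc p
  t′ = fromℕ t
  n′ = fromℕ n
  N = n′ * (n′ + t′)
  A = a₀ t′ n′ ∷ a₁ t′ n′ ∷ a₂ t′ n′ ∷ []
  B = b₀ t′ n′ ∷ b₁ t′ n′ ∷ []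
  X-1 = X -ₚ const 1ℚ

  open Symbolic using (left; right; left≡right)
  -- The common multiple is taken at m = p + 3, one above the largest m in the recurrence, since
  -- `invFacts-pred` raises m by one.
  open Evaluation (facts t p) (invFacts t (suc (suc n)) j) (fromℤ j) (½ * t′) (fromℕ p)

  suc↦ : ∀ {m q} → fromℕ m ↦ q → fromℕ (suc m) ↦ q :+ con (+ 1)
  suc↦ {m} (by m≡) = by (trans (fromℕ-suc m) (cong (_+ 1ℚ) m≡))

  pred↦ : ∀ {i q} → fromℤ i ↦ q → fromℤ (ℤ.pred i) ↦ q :- con (+ 1)
  pred↦ {i} (by i≡) = by (trans (fromℤ-pred i) (cong (_- 1ℚ) i≡))

  t↦ : t′ ↦ Symbolic.t
  t↦ = by (sym (trans (solve 2 (λ h t → h :* t :+ h :* t := (h :+ h) :* t) refl ½ t′) (*-identityˡ t′)))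

  f₀↦ : facts t p ↦ Symbolic.f₀
  f₀↦ = by refl

  b↦ : invFacts t (suc (suc n)) j ↦ Symbolic.b
  b↦ = by refl

  k↦ : fromℤ j ↦ Symbolic.k
  k↦ = by refl

  n₀↦ : fromℕ p ↦ Symbolic.n₀
  n₀↦ = by refl

  n↦ : n′ ↦ Symbolic.n
  n↦ = suc↦ {p} n₀↦

  n₂↦ : fromℕ (suc n) ↦ Symbolic.n₂
  n₂↦ = suc↦ {n} n↦

  k₁↦ : fromℤ (ℤ.pred j) ↦ Symbolic.k₁
  k₁↦ = pred↦ {j} k↦

  k₂↦ : fromℤ (ℤ.pred (ℤ.pred j)) ↦ Symbolic.k₂
  k₂↦ = pred↦ {ℤ.pred j} k₁↦

  k₃↦ : fromℤ (ℤ.pred (ℤ.pred (ℤ.pred j))) ↦ Symbolic.k₃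
  k₃↦ = pred↦ {ℤ.pred (ℤ.pred j)} k₂↦

  f₁↦ : facts t n ↦ Symbolic.f₁
  f₁↦ = factsSuc↦ t↦ n₀↦ f₀↦ (facts-suc t p)

  f₂↦ : facts t (suc n) ↦ Symbolic.f₂
  f₂↦ = factsSuc↦ t↦ n↦ f₁↦ (facts-suc t n)

  b₂₀↦ : invFacts t (suc n) j ↦ Symbolic.b₂₀
  b₂₀↦ = invFactsSuc↦ t↦ n₂↦ b↦ (invFacts-suc t (suc n) j)

  b₂₁↦ : invFacts t (suc n) (ℤ.pred j) ↦ Symbolic.b₂₁
  b₂₁↦ = invFactsPred↦ k↦ b↦ (invFacts-pred t (suc n) j)

  b₁₀↦ : invFacts t n j ↦ Symbolic.b₁₀
  b₁₀↦ = invFactsSuc↦ t↦ n↦ b₂₀↦ (invFacts-suc t n j)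

  b₁₁↦ : invFacts t n (ℤ.pred j) ↦ Symbolic.b₁₁
  b₁₁↦ = invFactsPred↦ k↦ b₂₀↦ (invFacts-pred t n j)

  b₁₂↦ : invFacts t n (ℤ.pred (ℤ.pred j)) ↦ Symbolic.b₁₂
  b₁₂↦ = invFactsPred↦ k₁↦ b₂₁↦ (invFacts-pred t n (ℤ.pred j))

  b₀₀↦ : invFacts t p j ↦ Symbolic.b₀₀
  b₀₀↦ = invFactsSuc↦ t↦ n₀↦ b₁₀↦ (invFacts-suc t p j)

  b₀₁↦ : invFacts t p (ℤ.pred j) ↦ Symbolic.b₀₁
  b₀₁↦ = invFactsPred↦ k↦ b₁₀↦ (invFacts-pred t p j)

  b₀₂↦ : invFacts t p (ℤ.pred (ℤ.pred j)) ↦ Symbolic.b₀₂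
  b₀₂↦ = invFactsPred↦ k₁↦ b₁₁↦ (invFacts-pred t p (ℤ.pred j))

  b₀₃↦ : invFacts t p (ℤ.pred (ℤ.pred (ℤ.pred j))) ↦ Symbolic.b₀₃
  b₀₃↦ = invFactsPred↦ k₂↦ b₁₂↦ (invFacts-pred t p (ℤ.pred (ℤ.pred j)))

  left↦ : (const ((n′ + t′ + 1ℚ) * (n′ + fromℕ 3)) · (c₀ t′ n′ ∷ c₁ t′ n′ ∷ []) · nbarCoeff t (suc n)) j ↦ left
  -- The iterated action reduces to the expression in the type of `lhs↦`, with the sequence read off
  -- at j and `ℤ.pred j`.
  left↦ = lhs↦ (c₀↦ t↦ n↦) (c₁↦ t↦ n↦) n↦ t↦
    (term↦ t↦ n₂↦ k↦ f₂↦ b₂₀↦) (term↦ t↦ n₂↦ k₁↦ f₂↦ b₂₁↦)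

  right↦ : (A · nbarCoeff t n) j - (const N · X-1 · X-1 · B · nbarCoeff t p) j ↦ right
  right↦ = rhs↦ (a₀↦ t↦ n↦) (a₁↦ t↦ n↦) (a₂↦ t↦ n↦) (b₀↦ t↦ n↦) (b₁↦ t↦ n↦) n↦ t↦
    (term↦ t↦ n↦ k↦ f₁↦ b₁₀↦) (term↦ t↦ n↦ k₁↦ f₁↦ b₁₁↦) (term↦ t↦ n↦ k₂↦ f₁↦ b₁₂↦)
    (term↦ t↦ n₀↦ k↦ f₀↦ b₀₀↦) (term↦ t↦ n₀↦ k₁↦ f₀↦ b₀₁↦)
    (term↦ t↦ n₀↦ k₂↦ f₀↦ b₀₂↦) (term↦ t↦ n₀↦ k₃↦ f₀↦ b₀₃↦)

theorem4p1 : (t n : ℕ) (1≤n : 1 ≤ n) →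
    let t′ = fromℕ t
        n′ = fromℕ n
        D≉0 = denominator≉0 t n 1≤n
    in fromPoly (Nbar t (suc n)) ≈ᶠ
         frac (a₀ t′ n′ ∷ a₁ t′ n′ ∷ a₂ t′ n′ ∷ []) (denominator t′ n′) D≉0
           *ᶠ fromPoly (Nbar t n)
         -ᶠ frac (const (n′ * (n′ + t′)) *ₚ ((X -ₚ const 1ℚ) *ₚ (X -ₚ const 1ℚ)) *ₚ (b₀ t′ n′ ∷ b₁ t′ n′ ∷ []))
                 (denominator t′ n′) D≉0
           *ᶠ fromPoly (Nbar t (n ∸ 1))
-- Since n ≥ 1, n is `suc p` and `n ∸ 1` reduces to p.
theorem4p1 t n@(suc p) 1≤n =
  clear-denominators D (denominator≉0 t n 1≤n) A B (Nbar t p) (Nbar t n) (Nbar t (suc n)) λ j → begin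
    (D · Nbar t (suc n) · δ) j                        ≡⟨ ·-cong D (Nbar·δ t (suc n)) j ⟩
    (D · nbarCoeff t (suc n)) j                       ≡⟨ nbarCoeff-recurrence t p j ⟩
    (A · nbarCoeff t n) j - (B · nbarCoeff t p) j     ≡⟨ cong₂ _-_ (·-cong A (Nbar·δ t n) j) (·-cong B (Nbar·δ t p) j) ⟨
    (A · Nbar t n · δ) j - (B · Nbar t p · δ) j       ∎
  where
  t′ = fromℕ t
  n′ = fromℕ n
  D = denominator t′ n′
  A = a₀ t′ n′ ∷ a₁ t′ n′ ∷ a₂ t′ n′ ∷ []
  B = const (n′ * (n′ + t′)) *ₚ ((X -ₚ const 1ℚ) *ₚ (X -ₚ const 1ℚ)) *ₚ (b₀ t′ n′ ∷ b₁ t′ n′ ∷ [])
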